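{- If a graph $G$ has no vertex-minor isomorphic to $P_5$, then $\chi(G)\le\omega(G)+1$.
   Context: $P_5$ is the path on $5$ vertices. For a vertex $v$ of a graph $G$, the local complementation $G*v$ is the graph on $V(G)$ in which distinct $x,y$ are adjacent iff exactly one of the following holds: both $x$ and $y$ are neighbors of $v$ in $G$; $x$ is adjacent to $y$ in $G$. A graph $H$ is a vertex-minor of $G$ if $H$ is an induced subgraph of a graph obtained from $G$ by a sequence of local complementations. -}

module Defs where

open import Data.Nat using (ℕ; suc; _≡ᵇ_)
open import Data.Fin using (Fin; toℕ; _≟_)
open import Data.Bool using (Bool; true; false; _∧_; _∨_; _xor_; if_then_else_)
open import Data.List using (List; foldl)
open import Data.Product using (Σ; _×_; ∃)
open import Relation.Binary.PropositionalEquality using (_≡_; _≢_)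
open import Relation.Nullary using (¬_; does)
open import Function.Definitions using (Injective)

record Graph : Set where
  field
    n     : ℕ
    adj   : Fin n → Fin n → Bool
    sym   : ∀ x y → adj x y ≡ adj y x
    irrefl : ∀ x → adj x x ≡ false
open Graph public

localComp : ∀ {n} → (Fin n → Fin n → Bool) → Fin n → (Fin n → Fin n → Bool)
localComp a v x y =
  if does (x ≟ y) then false else ((a v x ∧ a v y) xor a x y)

localCompSeq : ∀ {n} → (Fin n → Fin n → Bool) → List (Fin n) → (Fin n → Fin n → Bool)
localCompSeq a vs = foldl localComp a vs

P5adj : Fin 5 → Fin 5 → Bool
P5adj i j = (suc (toℕ i) ≡ᵇ toℕ j) ∨ (suc (toℕ j) ≡ᵇ toℕ i)

HasP5VertexMinor : Graph → Set
HasP5VertexMinor G =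
  Σ (List (Fin (n G))) λ vs →
  Σ (Fin 5 → Fin (n G)) λ f →
    Injective _≡_ _≡_ f ×
    (∀ i j → localCompSeq (adj G) vs (f i) (f j) ≡ P5adj i j)

HasClique : (G : Graph) → ℕ → Set
HasClique G k =
  Σ (Fin k → Fin (n G)) λ f →
    Injective _≡_ _≡_ f × (∀ i j → i ≢ j → adj G (f i) (f j) ≡ true)

IsCliqueNumber : Graph → ℕ → Set
IsCliqueNumber G w = HasClique G w × ¬ HasClique G (suc w)

Colorable : Graph → ℕ → Set
Colorable G k =
  Σ (Fin (n G) → Fin k) λ c → ∀ x y → adj G x y ≡ true → c x ≢ c y

{-# OPTIONS --safe #-}

-- Each connected component is coloured separately; as G has no induced P5, components have
-- radius at most 3, so connectedness is decidable.
-- A triangle-free component is 3-coloured by the distance from a vertex v, vertices at distance 2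
-- being split according to their adjacency to a fixed neighbour of v.
-- Otherwise take a maximal clique K with at least 3 vertices. If the vertices outside K are
-- independent, ω(G) + 1 colours suffice. If not, connectedness yields an edge xy outside K with x
-- adjacent to K, and by maximality there are a, b, c in K with x ~ a, x ≁ b and y not adjacent to
-- all of a, b, c. A finite check shows that {a, b, c, x, y} is 3-colourable and that a further
-- edge attached to these five vertices would create a P5 vertex-minor. So the remaining
-- vertices are independent and a fourth colour suffices.
module Submission where

open import Defs
open import Data.Bool using (Bool; true; false; _∧_; _∨_; not; _xor_)
import Data.Bool.Properties as Bool
open import Data.Empty using (⊥; ⊥-elim)
open import Data.Fin using (Fin; zero; suc; _≟_; inject≤; #_)
import Data.Fin as Fin
import Data.Fin.Properties as Fin
open import Data.List using (List; []; _∷_)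
open import Data.List.Relation.Unary.Any as Any using (Any; here; there)
open import Data.Nat using (ℕ; zero; suc; _+_; _≤_; z≤n; s≤s)
import Data.Nat.Properties as ℕ
open import Data.Product using (Σ; ∃; _×_; _,_; proj₁; proj₂)
open import Data.Sum using (_⊎_; inj₁; inj₂; [_,_]′)
open import Data.Unit using (⊤; tt)
open import Data.Vec using (Vec; []; _∷_; lookup; tabulate)
open import Data.Vec.Properties using (lookup∘tabulate)
import Data.Vec.Functional as VF
open import Function using (_∘_)
open import Function.Definitions using (Injective)
open import Relation.Binary.Construct.Closure.ReflexiveTransitive
  using (Star; ε; _◅_; _◅◅_; reverse)
open import Relation.Binary.PropositionalEquality as ≡
  using (_≡_; _≢_; refl; trans; cong; cong₂; subst)
open import Relation.Nullary using (¬_; Dec; yes; no; contradiction; ¬?)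
open import Relation.Nullary.Decidable
  using (_×-dec_; _⊎-dec_; _→-dec_; map′; from-yes; toWitness; decidable-stable)
open import Relation.Unary using (Decidable)

-- Adjacency functions under local complementation.

Adj : ℕ → Set
Adj m = Fin m → Fin m → Bool

Symm : ∀ {m} → Adj m → Set
Symm a = ∀ x y → a x y ≡ a y x

Irrefl : ∀ {m} → Adj m → Set
Irrefl a = ∀ x → a x x ≡ false

true≢false : ∀ {b} → b ≡ true → b ≡ false → ⊥
true≢false refl ()

localComp-symm : ∀ {m} {a : Adj m} v → Symm a → Symm (localComp a v)
localComp-symm {a = a} v s x y with x ≟ y | y ≟ x
... | yes _ | yes _ = refl
... | yes p | no ¬q = contradiction (≡.sym p) ¬q
... | no ¬p | yes q = contradiction (≡.sym q) ¬p
... | no _ | no _ = cong₂ _xor_ (Bool.∧-comm (a v x) (a v y)) (s x y)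

localComp-irrefl : ∀ {m} {a : Adj m} v → Irrefl (localComp a v)
localComp-irrefl v x with x ≟ x
... | yes _ = refl
... | no ¬p = contradiction refl ¬p

-- Induced five-vertex paths and an executable test for them.

InducedP5 : ∀ {m} → Adj m → Set
InducedP5 a =
  ∃ λ p → ∃ λ q → a p q ≡ true ×
  ∃ λ r → (a q r ≡ true × a p r ≡ false) ×
  ∃ λ s → (a r s ≡ true × a q s ≡ false × a p s ≡ false) ×
  ∃ λ t → a s t ≡ true × a r t ≡ false × a q t ≡ false × a p t ≡ false

anyFin : ∀ {m} → (Fin m → Bool) → Bool
anyFin {zero}  f = false
anyFin {suc m} f = f zero ∨ anyFin (f ∘ suc)

anyFin-sound : ∀ {m} (f : Fin m → Bool) → anyFin f ≡ true → ∃ λ i → f i ≡ true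
anyFin-sound {suc m} f h with f zero in eq
... | true  = zero , eq
... | false with anyFin-sound (f ∘ suc) h
...   | i , fi = suc i , fi

∧-true : ∀ {b c} → b ∧ c ≡ true → b ≡ true × c ≡ true
∧-true {true} {true} _ = refl , refl

not-true : ∀ {b} → not b ≡ true → b ≡ false
not-true {false} _ = refl

-- Each vertex is tested as soon as it is chosen, so a failing branch is cut before the next vertex
-- is tried. This keeps the evaluation of the finite check affordable.
hasInducedP5 : ∀ {m} → Adj m → Bool
hasInducedP5 a =
  anyFin λ p → anyFin λ q → a p q ∧
  anyFin λ r → (a q r ∧ not (a p r)) ∧
  anyFin λ s → (a r s ∧ not (a q s) ∧ not (a p s)) ∧
  anyFin λ t → a s t ∧ not (a r t) ∧ not (a q t) ∧ not (a p t)

hasInducedP5-sound : ∀ {m} (a : Adj m) → hasInducedP5 a ≡ true → InducedP5 a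
hasInducedP5-sound a h
  with p , h ← anyFin-sound _ h
  with q , h ← anyFin-sound _ h
  with pq , h ← ∧-true h
  with r , h ← anyFin-sound _ h
  with hr , h ← ∧-true h
  with qr , pr ← ∧-true hr
  with s , h ← anyFin-sound _ h
  with hs , h ← ∧-true h
  with rs , hs ← ∧-true hs
  with qs , ps ← ∧-true hs
  with t , h ← anyFin-sound _ h
  with st , h ← ∧-true h
  with rt , h ← ∧-true h
  with qt , pt ← ∧-true h
  = p , q , pq , r , (qr , not-true pr) , s , (rs , not-true qs , not-true ps) ,
    t , st , not-true rt , not-true qt , not-true pt

fromTable : ∀ {m} → Vec (Vec Bool m) m → Adj m
fromTable t i j = lookup (lookup t i) j

-- Pointwise the identity. Passing the table as an argument of fromTable makes evaluation
-- compute it only once for all entries.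
memo : ∀ {m} → Adj m → Adj m
memo a = fromTable (tabulate λ i → tabulate (a i))

memo-≡ : ∀ {m} (a : Adj m) i j → memo a i j ≡ a i j
memo-≡ a i j = trans (cong (λ r → lookup r j) (lookup∘tabulate (λ i → tabulate (a i)) i))
                     (lookup∘tabulate (a i) j)

hasP5After : ∀ {m} → List (Fin m) → Adj m → Bool
hasP5After []       a = hasInducedP5 a
hasP5After (v ∷ vs) a = hasP5After vs (memo (localComp a v))

-- Small graphs as Boolean data, and the finite check.

-- The upper triangle of an adjacency matrix, row by row.
Mat : ℕ → Set
Mat zero    = ⊤
Mat (suc m) = Vec Bool m × Mat m

entry : ∀ {m} → Mat m → Adj m
entry {suc m} _       zero    zero    = false
entry {suc m} (r , _) zero    (suc j) = lookup r j
entry {suc m} (r , _) (suc i) zero    = lookup r i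
entry {suc m} (_ , M) (suc i) (suc j) = entry M i j

allVec? : ∀ {m} {P : Vec Bool m → Set} → Decidable P → Dec (∀ r → P r)
allVec? {zero}  P? = map′ (λ { p [] → p }) (λ f → f []) (P? [])
allVec? {suc m} P? =
  map′ (λ { (f , t) (false ∷ r) → f r ; (f , t) (true ∷ r) → t r })
       (λ f → (λ r → f (false ∷ r)) , (λ r → f (true ∷ r)))
       (allVec? (λ r → P? (false ∷ r)) ×-dec allVec? (λ r → P? (true ∷ r)))

anyColouring? : ∀ {k m} {P : Vec (Fin k) m → Set} → Decidable P → Dec (∃ P)
anyColouring? {m = zero}  P? = map′ (λ p → [] , p) (λ { ([] , p) → p }) (P? [])
anyColouring? {m = suc m} P? =
  map′ (λ { (x , c , p) → x ∷ c , p }) (λ { (x ∷ c , p) → x , c , p })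
       (Fin.any? λ x → anyColouring? λ c → P? (x ∷ c))

Proper : ∀ {m k} → Adj m → (Fin m → Fin k) → Set
Proper a c = ∀ i j → a i j ≡ true → c i ≢ c j

proper? : ∀ {m k} (a : Adj m) (c : Fin m → Fin k) → Dec (Proper a c)
proper? a c = Fin.all? λ i → Fin.all? λ j → (a i j Bool.≟ true) →-dec ¬? (c i ≟ c j)

-- The vertices are y, x, c, b, a in this order: a triangle abc and an edge xy with x ~ a, x ≁ b.
triangleWithEdge : Vec Bool 4 → Mat 5
triangleWithEdge (yc ∷ yb ∷ ya ∷ xc ∷ []) =
    (true ∷ yc ∷ yb ∷ ya ∷ [])
  , (xc ∷ false ∷ true ∷ [])
  , (true ∷ true ∷ [])
  , (true ∷ [])
  , [] , tt

-- Found by a computer search: the local complementations after which an induced P5 appears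
-- in the graphs on 5, 6 and 7 vertices occurring in Special.
candidates₅ : List (List (Fin 5))
candidates₅ = (# 2 ∷ # 3 ∷ # 0 ∷ []) ∷ (# 4 ∷ # 3 ∷ # 0 ∷ []) ∷ (# 3 ∷ # 0 ∷ # 1 ∷ []) ∷ []

candidates₆ : List (List (Fin 6))
candidates₆ =
  (# 4 ∷ # 0 ∷ []) ∷ (# 3 ∷ # 0 ∷ []) ∷ (# 5 ∷ # 0 ∷ []) ∷ (# 0 ∷ # 1 ∷ []) ∷ (# 0 ∷ # 2 ∷ []) ∷
  (# 1 ∷ # 2 ∷ # 1 ∷ []) ∷ (# 0 ∷ # 4 ∷ []) ∷ (# 2 ∷ # 1 ∷ []) ∷ (# 1 ∷ # 0 ∷ []) ∷ (# 4 ∷ # 3 ∷ []) ∷ []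

candidates₇ : List (List (Fin 7))
candidates₇ =
  (# 0 ∷ # 5 ∷ []) ∷ (# 1 ∷ # 0 ∷ []) ∷ (# 4 ∷ # 5 ∷ []) ∷ (# 4 ∷ []) ∷ (# 6 ∷ # 0 ∷ []) ∷ []

opaque
  -- Opaque, so that the search is evaluated in the finite check only and not wherever its outcome
  -- is used.
  P5Among : ∀ {m} → List (List (Fin m)) → Mat m → Set
  P5Among vss M = Any (λ vs → hasP5After vs (entry M) ≡ true) vss

  p5Among? : ∀ {m} vss (M : Mat m) → Dec (P5Among vss M)
  p5Among? vss M = Any.any? (λ vs → hasP5After vs (entry M) Bool.≟ true) vss

NonZero : ∀ {m} → Vec Bool m → Set
NonZero r = ∃ λ i → lookup r i ≡ true

nonZero? : ∀ {m} → Decidable (NonZero {m})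
nonZero? r = Fin.any? λ i → lookup r i Bool.≟ true

-- Either the five-vertex graph is itself excluded, or it is 3-colourable and excludes every edge
-- zz' outside it with z attached to it. Here `r` is the row of z, and `true ∷ s` is the row of z',
-- its leading entry being the edge zz'.
Special : Mat 5 → Set
Special M =
  P5Among candidates₅ M ⊎
  (∃ λ (c : Vec (Fin 3) 5) → Proper (entry M) (lookup c)) ×
  (∀ r → NonZero r →
     P5Among candidates₆ (r , M) ⊎ (∀ s → P5Among candidates₇ (true ∷ s , r , M)))

special? : Decidable Special
special? M =
  p5Among? candidates₅ M ⊎-dec
  (anyColouring? λ c → proper? (entry M) (lookup c)) ×-dec
  (allVec? λ r → nonZero? r →-dec
     (p5Among? candidates₆ (r , M) ⊎-dec
      (allVec? λ s → p5Among? candidates₇ (true ∷ s , r , M))))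

opaque
  unfolding P5Among

  -- The hypothesis says that y is not adjacent to all of a, b and c.
  triangleWithEdge-special : ∀ bits → (∃ λ (i : Fin 3) → lookup bits (Fin.inject₁ i) ≡ false) →
                             Special (triangleWithEdge bits)
  triangleWithEdge-special =
    toWitness {a? = allVec? λ bits → (Fin.any? λ (i : Fin 3) → lookup bits (Fin.inject₁ i) Bool.≟ false)
                      →-dec special? (triangleWithEdge bits)} tt

-- Induced copies and their transfer to vertex-minors.

P5adj-rows : ∀ i j → (∀ k → P5adj i k ≡ P5adj j k) → i ≡ j
P5adj-rows = from-yes
  (Fin.all? λ i → Fin.all? λ j → (Fin.all? λ k → P5adj i k Bool.≟ P5adj j k) →-dec (i ≟ j))

record Copy {n m} (g : Adj n) (e : Fin m → Fin n) (a : Adj m) : Set where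
  field
    injective : Injective _≡_ _≡_ e
    agrees    : ∀ i j → g (e i) (e j) ≡ a i j

copy-P5 : ∀ {m} {a : Adj m} → Symm a → Irrefl a → InducedP5 a → ∃ λ f → Copy a f P5adj
copy-P5 {m} {a} s irr
  (p , q , pq , r , (qr , pr) , t , (rt , qt , pt) , u , tu , ru , qu , pu) =
  f , record { injective = inj ; agrees = agr }
  where
  f : Fin 5 → Fin m
  f = lookup (p ∷ q ∷ r ∷ t ∷ u ∷ [])
  flip : ∀ {x y b} → a x y ≡ b → a y x ≡ b
  flip {x} {y} h = trans (s y x) h
  agr : ∀ i j → a (f i) (f j) ≡ P5adj i j
  agr = λ where
    zero zero → irr p
    zero (suc zero) → pq
    zero (suc (suc zero)) → pr
    zero (suc (suc (suc zero))) → pt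
    zero (suc (suc (suc (suc zero)))) → pu
    (suc zero) zero → flip pq
    (suc zero) (suc zero) → irr q
    (suc zero) (suc (suc zero)) → qr
    (suc zero) (suc (suc (suc zero))) → qt
    (suc zero) (suc (suc (suc (suc zero)))) → qu
    (suc (suc zero)) zero → flip pr
    (suc (suc zero)) (suc zero) → flip qr
    (suc (suc zero)) (suc (suc zero)) → irr r
    (suc (suc zero)) (suc (suc (suc zero))) → rt
    (suc (suc zero)) (suc (suc (suc (suc zero)))) → ru
    (suc (suc (suc zero))) zero → flip pt
    (suc (suc (suc zero))) (suc zero) → flip qt
    (suc (suc (suc zero))) (suc (suc zero)) → flip rt
    (suc (suc (suc zero))) (suc (suc (suc zero))) → irr t
    (suc (suc (suc zero))) (suc (suc (suc (suc zero)))) → tu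
    (suc (suc (suc (suc zero)))) zero → flip pu
    (suc (suc (suc (suc zero)))) (suc zero) → flip qu
    (suc (suc (suc (suc zero)))) (suc (suc zero)) → flip ru
    (suc (suc (suc (suc zero)))) (suc (suc (suc zero))) → flip tu
    (suc (suc (suc (suc zero)))) (suc (suc (suc (suc zero)))) → irr u
  inj : Injective _≡_ _≡_ f
  -- No two vertices of the path have the same neighbourhood, so agreement of adjacencies already
  -- forces injectivity.
  inj {i} {j} fi≡fj = P5adj-rows i j λ k →
    trans (≡.sym (agr i k)) (trans (cong (λ x → a x (f k)) fi≡fj) (agr j k))

copy-symm : ∀ {n m} {g : Adj n} {e : Fin m → Fin n} {a} → Copy g e a → Symm g → Symm a
copy-symm {e = e} c s i j = trans (≡.sym (agrees i j)) (trans (s (e i) (e j)) (agrees j i))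
  where open Copy c

copy-irrefl : ∀ {n m} {g : Adj n} {e : Fin m → Fin n} {a} → Copy g e a → Irrefl g → Irrefl a
copy-irrefl {e = e} c irr i = trans (≡.sym (Copy.agrees c i i)) (irr (e i))

copy-trans : ∀ {n m l} {g : Adj n} {e : Fin m → Fin n} {a} {f : Fin l → Fin m} {b} →
             Copy g e a → Copy a f b → Copy g (e ∘ f) b
copy-trans {f = f} c d = record
  { injective = d.injective ∘ c.injective
  ; agrees    = λ i j → trans (c.agrees (f i) (f j)) (d.agrees i j) }
  where module c = Copy c
        module d = Copy d

-- Complementing at a vertex of an induced subgraph commutes with restricting to it. Injectivity of
-- `e` makes the two diagonal tests agree.
copy-localComp : ∀ {n m} {g : Adj n} {e : Fin m → Fin n} {a} v → Copy g e a →
                 Copy (localComp g (e v)) e (memo (localComp a v))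
copy-localComp {g = g} {e} {a} v c = record { injective = injective ; agrees = agr }
  where
  open Copy c
  agr′ : ∀ i j → localComp g (e v) (e i) (e j) ≡ localComp a v i j
  agr′ i j with e i ≟ e j | i ≟ j
  ... | yes _ | yes _ = refl
  ... | yes p | no ¬q = contradiction (injective p) ¬q
  ... | no ¬p | yes q = contradiction (cong e q) ¬p
  ... | no _  | no _  = cong₂ _xor_ (cong₂ _∧_ (agrees v i) (agrees v j)) (agrees i j)
  agr : ∀ i j → localComp g (e v) (e i) (e j) ≡ memo (localComp a v) i j
  agr i j = trans (agr′ i j) (≡.sym (memo-≡ (localComp a v) i j))

P5VertexMinor : ∀ {n} → Adj n → Set
P5VertexMinor g = ∃ λ vs → ∃ λ f → Copy (localCompSeq g vs) f P5adj

-- The complementations found in the small graph are replayed in `g` at the images of their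
-- vertices, and the copy survives each of them.
hasP5After⇒minor : ∀ {n m} {g : Adj n} {e : Fin m → Fin n} {a} → Symm g → Irrefl g → Copy g e a →
                   ∀ vs → hasP5After vs a ≡ true → P5VertexMinor g
hasP5After⇒minor {e = e} {a} s irr c [] h =
  let f , d = copy-P5 (copy-symm c s) (copy-irrefl c irr) (hasInducedP5-sound a h)
  in [] , e ∘ f , copy-trans c d
hasP5After⇒minor {g = g} {e} {a} s irr c (v ∷ vs) h =
  let us , f , d = hasP5After⇒minor {g = localComp g (e v)} {e} {memo (localComp a v)}
                     (localComp-symm {a = g} (e v) s) (localComp-irrefl {a = g} (e v))
                     (copy-localComp v c) vs h
  in e v ∷ us , f , d

module _ {n m} {g : Adj n} {e : Fin m → Fin n} {M : Mat m} where

  copy-∷ : Symm g → Irrefl g → Copy g e (entry M) →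
           ∀ {z r} → (∀ i → e i ≢ z) → (∀ i → g z (e i) ≡ lookup r i) →
           Copy g (z VF.∷ e) (entry {suc m} (r , M))
  copy-∷ s irr c {z} {r} fresh row = record { injective = inj ; agrees = agr }
    where
    open Copy c
    inj : Injective _≡_ _≡_ (z VF.∷ e)
    inj {zero}  {zero}  _ = refl
    inj {zero}  {suc j} p = contradiction (≡.sym p) (fresh j)
    inj {suc i} {zero}  p = contradiction p (fresh i)
    inj {suc i} {suc j} p = cong suc (injective p)
    agr : ∀ i j → g ((z VF.∷ e) i) ((z VF.∷ e) j) ≡ entry {suc m} (r , M) i j
    agr zero    zero    = irr z
    agr zero    (suc j) = row j
    agr (suc i) zero    = trans (s (e i) z) (row i)
    agr (suc i) (suc j) = agrees i j

copy-[] : ∀ {n} {g : Adj n} → Copy g VF.[] (entry tt)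
copy-[] = record { injective = λ { {()} } ; agrees = λ () }

-- Least elements, and an index avoiding two others.

Least : ∀ {n} → (Fin n → Set) → Fin n → Set
Least P i = P i × ∀ j → P j → i Fin.≤ j

least : ∀ {n} {P : Fin n → Set} → Decidable P → ∃ P → ∃ (Least P)
least {suc n} P? (i , p) with P? zero
... | yes p₀ = zero , p₀ , λ _ _ → z≤n
least {suc n} P? (zero  , p) | no ¬p₀ = contradiction p ¬p₀
least {suc n} P? (suc i , p) | no ¬p₀ with j , q , min ← least (P? ∘ suc) (i , p) =
  suc j , q , λ { zero p₀ → contradiction p₀ ¬p₀ ; (suc k) r → s≤s (min k r) }

-- Serves to give adjacent vertices the same component root.
least-unique : ∀ {n} {P Q : Fin n → Set} → (∀ {i} → P i → Q i) → (∀ {i} → Q i → P i) →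
               ∀ {i j} → Least P i → Least Q j → i ≡ j
least-unique P⊆Q Q⊆P {i} {j} (p , minP) (q , minQ) =
  Fin.≤-antisym (minP j (Q⊆P q)) (minQ i (P⊆Q p))

third : ∀ {k} (i j : Fin (3 + k)) → ∃ λ l → l ≢ i × l ≢ j
third zero          zero          = # 1 , (λ ()) , λ ()
third zero          (suc zero)    = # 2 , (λ ()) , λ ()
third zero          (suc (suc _)) = # 1 , (λ ()) , λ ()
third (suc zero)    zero          = # 2 , (λ ()) , λ ()
third (suc zero)    (suc _)       = # 0 , (λ ()) , λ ()
third (suc (suc _)) zero          = # 1 , (λ ()) , λ ()
third (suc (suc _)) (suc _)       = # 0 , (λ ()) , λ ()

-- Walks, components and colouring by components.

module _ (G : Graph) where

  private
    V = Fin (n G)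
    variable
      k : ℕ
      x y z : V

  infix 4 _~_ _≁_ _~?_ _↝_

  _~_ _≁_ : V → V → Set
  x ~ y = adj G x y ≡ true
  x ≁ y = adj G x y ≡ false

  _~?_ : ∀ x y → Dec (x ~ y)
  x ~? y = adj G x y Bool.≟ true

  ¬~⇒≁ : ¬ x ~ y → x ≁ y
  ¬~⇒≁ = Bool.¬-not

  ~-sym : x ~ y → y ~ x
  ~-sym {x} {y} = trans (sym G y x)

  ≁-sym : x ≁ y → y ≁ x
  ≁-sym {x} {y} = trans (sym G y x)

  ~⇒≢ : x ~ y → x ≢ y
  ~⇒≢ {x} xy refl = true≢false xy (irrefl G x)

  _↝_ : V → V → Set
  _↝_ = Star _~_

  ↝-sym : x ↝ y → y ↝ x
  ↝-sym = reverse ~-sym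

  step : x ~ y → x ↝ y
  step xy = xy ◅ ε

  closed-under-↝ : (P : V → Set) → (∀ {x y} → P x → x ~ y → P y) → x ↝ y → P x → P y
  closed-under-↝ P cl ε        p = p
  closed-under-↝ P cl (e ◅ es) p = closed-under-↝ P cl es (cl p e)

  -- The colouring is total on `V` but constrained only on edges reachable from `v`, which avoids a
  -- separate type of component vertices.
  ColoursComponent : ℕ → V → Set
  ColoursComponent k v = Σ (V → Fin k) λ c → ∀ {x y} → v ↝ x → x ~ y → c x ≢ c y

  coloursComponent-↝ : x ↝ y → ColoursComponent k y → ColoursComponent k x
  coloursComponent-↝ xy (c , h) = c , λ xz → h (↝-sym xy ◅◅ xz)

  -- A vertex takes its colour from the colouring chosen for the least vertex of its component. The
  -- ends of an edge share that root, so one proper colouring governs both.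
  coloursComponents⇒colourable : (∀ x y → Dec (x ↝ y)) → (∀ v → ColoursComponent k v) →
                                 Colorable G k
  coloursComponents⇒colourable _↝?_ h = colour , proper
    where
    root : ∀ x → ∃ (Least (x ↝_))
    root x = least (x ↝?_) (x , ε)
    root-≡ : ∀ {x y} → x ~ y → proj₁ (root x) ≡ proj₁ (root y)
    root-≡ {x} {y} xy = least-unique (~-sym xy ◅_) (xy ◅_) (proj₂ (root x)) (proj₂ (root y))
    colour : V → Fin _
    colour x = proj₁ (h (proj₁ (root x))) x
    proper : ∀ x y → adj G x y ≡ true → colour x ≢ colour y
    proper x y xy eq = proj₂ (h (proj₁ (root x))) (↝-sym (proj₁ (proj₂ (root x)))) xy
      (trans eq (cong (λ r → proj₁ (h r) y) (≡.sym (root-≡ xy))))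

  -- Extending a colouring of a vertex set by one colour.

  Member : (Fin k → V) → V → Set
  Member S x = ∃ λ i → S i ≡ x

  member? : (S : Fin k → V) → Decidable (Member S)
  member? S x = Fin.any? λ i → S i ≟ x

  AttachedEdge : (Fin k → V) → Set
  AttachedEdge S = ∃ λ i → ∃ λ x → ∃ λ y → S i ~ x × x ~ y × ¬ Member S x × ¬ Member S y

  attachedEdge? : (S : Fin k → V) → Dec (AttachedEdge S)
  attachedEdge? S = Fin.any? λ i → Fin.any? λ x → Fin.any? λ y →
    (S i ~? x) ×-dec (x ~? y) ×-dec ¬? (member? S x) ×-dec ¬? (member? S y)

  -- Without attached edges, every vertex of the component is in S or adjacent to S,
  -- so the vertices outside S are independent and can share one additional colour.
  colour-or-attachedEdge : ∀ {w} (S : Fin k → V) (c : Fin k → Fin w) →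
    (∀ i j → S i ~ S j → c i ≢ c j) → ∀ i →
    ColoursComponent (suc w) (S i) ⊎ AttachedEdge S
  colour-or-attachedEdge {w = w} S c proper i₀ with attachedEdge? S
  ... | yes e = inj₂ e
  ... | no ¬e = inj₁ (colour , colour-proper)
    where
    Near : V → Set
    Near x = Member S x ⊎ ∃ λ i → S i ~ x

    near-closed : Near x → x ~ y → Near y
    near-closed {x} {y} nx xy with member? S x | member? S y | nx
    ... | _              | yes my | _              = inj₁ my
    ... | yes (i , refl) | no _   | _              = inj₂ (i , xy)
    ... | no ¬mx         | no ¬my | inj₁ mx        = contradiction mx ¬mx
    ... | no ¬mx         | no ¬my | inj₂ (i , ix)  = contradiction (i , x , y , ix , xy , ¬mx , ¬my) ¬e

    colour : V → Fin (suc w)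
    -- The colours of `S` are shifted by one to keep `zero` for the vertices outside.
    colour x with member? S x
    ... | yes (i , _) = suc (c i)
    ... | no _        = zero

    colour-proper : ∀ {x y} → S i₀ ↝ x → x ~ y → colour x ≢ colour y
    colour-proper {x} {y} r xy eq with member? S x | member? S y
    ... | yes (i , refl) | yes (j , refl) = proper i j xy (Fin.suc-injective eq)
    ... | no ¬mx | no ¬my with closed-under-↝ Near near-closed r (inj₁ (i₀ , refl))
    ...   | inj₁ mx       = ¬mx mx
    ...   | inj₂ (i , ix) = ¬e (i , x , y , ix , xy , ¬mx , ¬my)

  -- Cliques.

  Pairwise~ : (Fin k → V) → Set
  Pairwise~ S = ∀ i j → i ≢ j → S i ~ S j

  pairwise~⇒injective : {S : Fin k → V} → Pairwise~ S → Injective _≡_ _≡_ S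
  pairwise~⇒injective S~ {i} {j} eq with i ≟ j
  ... | yes p = p
  ... | no ¬p = contradiction eq (~⇒≢ (S~ i j ¬p))

  pairwise~⇒↝ : {S : Fin k → V} → Pairwise~ S → ∀ i j → S i ↝ S j
  pairwise~⇒↝ S~ i j with i ≟ j
  ... | yes refl = ε
  ... | no ¬p = step (S~ i j ¬p)

  pairwise~-∷ : {S : Fin k → V} → Pairwise~ S → (∀ i → S i ~ x) → Pairwise~ (x VF.∷ S)
  pairwise~-∷ S~ h zero    zero    i≢j = contradiction refl i≢j
  pairwise~-∷ S~ h zero    (suc j) i≢j = ~-sym (h j)
  pairwise~-∷ S~ h (suc i) zero    i≢j = h i
  pairwise~-∷ S~ h (suc i) (suc j) i≢j = S~ i j (i≢j ∘ cong suc)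

  pairwise~-[] : Pairwise~ VF.[]
  pairwise~-[] ()

  -- Reachability when the path is excluded.

  module _ (noP5 : ¬ HasP5VertexMinor G) where

    ¬copy : ∀ {m} {e : Fin m → V} {a} → Copy (adj G) e a → ∀ vs → ¬ hasP5After vs a ≡ true
    ¬copy c vs h with us , f , d ← hasP5After⇒minor (sym G) (irrefl G) c vs h =
      noP5 (us , f , Copy.injective d , Copy.agrees d)

    opaque
      unfolding P5Among

      ¬p5Among : ∀ {m} {e : Fin m → V} {M} → Copy (adj G) e (entry M) → ∀ vss → ¬ P5Among vss M
      ¬p5Among c (vs ∷ _)  (here h)  = ¬copy c vs h
      ¬p5Among c (_ ∷ vss) (there h) = ¬p5Among c vss h

    ¬inducedP5 : ¬ InducedP5 (adj G)
    ¬inducedP5 p with f , d ← copy-P5 (sym G) (irrefl G) p =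
      noP5 ([] , f , Copy.injective d , Copy.agrees d)

    Within₃ : V → V → Set
    Within₃ v x = v ≡ x ⊎ v ~ x ⊎ (∃ λ p → v ~ p × p ~ x) ⊎ (∃ λ p → v ~ p × ∃ λ q → p ~ q × q ~ x)

    within₃? : ∀ v x → Dec (Within₃ v x)
    within₃? v x =
      (v ≟ x) ⊎-dec (v ~? x) ⊎-dec
      (Fin.any? λ p → (v ~? p) ×-dec (p ~? x)) ⊎-dec
      (Fin.any? λ p → (v ~? p) ×-dec Fin.any? λ q → (p ~? q) ×-dec (q ~? x))

    -- In a walk v, p, q, x, y any chord would lead from v to y in at most three steps. Without such
    -- a shortcut the walk is an induced path on five vertices.
    within₃-closed : ∀ {v} → Within₃ v x → x ~ y → Within₃ v y
    within₃-closed (inj₁ refl) xy = inj₂ (inj₁ xy)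
    within₃-closed (inj₂ (inj₁ vx)) xy = inj₂ (inj₂ (inj₁ (_ , vx , xy)))
    within₃-closed (inj₂ (inj₂ (inj₁ (p , vp , px)))) xy = inj₂ (inj₂ (inj₂ (p , vp , _ , px , xy)))
    within₃-closed {x} {y} {v} (inj₂ (inj₂ (inj₂ (p , vp , q , pq , qx)))) xy
      with within₃? v y
    ... | yes w = w
    ... | no ¬w = ⊥-elim (¬inducedP5
      ( v , p , vp
      , q , (pq , ¬~⇒≁ λ vq → ¬w (inj₂ (inj₂ (inj₂ (q , vq , x , qx , xy)))))
      , x , (qx , (¬~⇒≁ λ px → ¬w (inj₂ (inj₂ (inj₂ (p , vp , x , px , xy))))) ,
                  ¬~⇒≁ λ vx → ¬w (inj₂ (inj₂ (inj₁ (x , vx , xy)))))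
      , y , xy , (¬~⇒≁ λ qy → ¬w (inj₂ (inj₂ (inj₂ (p , vp , q , pq , qy))))) ,
            (¬~⇒≁ λ py → ¬w (inj₂ (inj₂ (inj₁ (p , vp , py))))) ,
            ¬~⇒≁ λ vy → ¬w (inj₂ (inj₁ vy)) ))

    ↝⇒within₃ : ∀ {v} → v ↝ x → Within₃ v x
    ↝⇒within₃ {v = v} r = closed-under-↝ (Within₃ v) within₃-closed r (inj₁ refl)

    within₃⇒↝ : ∀ {v} → Within₃ v x → v ↝ x
    within₃⇒↝ (inj₁ refl) = ε
    within₃⇒↝ (inj₂ (inj₁ vx)) = step vx
    within₃⇒↝ (inj₂ (inj₂ (inj₁ (_ , vp , px)))) = vp ◅ px ◅ ε
    within₃⇒↝ (inj₂ (inj₂ (inj₂ (_ , vp , _ , pq , qx)))) = vp ◅ pq ◅ qx ◅ ε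

    _↝?_ : ∀ x y → Dec (x ↝ y)
    x ↝? y = map′ within₃⇒↝ ↝⇒within₃ (within₃? x y)

    -- Triangle-free components.

    module TriangleFree {v p} (vp : v ~ p)
      (¬triangle : ∀ {a b c} → v ↝ a → a ~ b → b ~ c → a ~ c → ⊥) where

      -- Distances 1 and 3 from v share a colour, as no edge joins them. The vertex v itself falls
      -- under `atP`, since p ~ v.
      data Layer (x : V) : Fin 3 → Set where
        atP  : v ≁ x → p ~ x → Layer x (# 0)
        near : v ~ x → Layer x (# 1)
        mid  : ∀ {q} → v ≁ x → p ≁ x → v ~ q → q ~ x → Layer x (# 2)
        far  : v ≁ x → p ≁ x → ¬ (∃ λ q → v ~ q × q ~ x) → Layer x (# 1)

      layer : ∀ x → ∃ (Layer x)
      layer x with v ~? x | p ~? x | Fin.any? (λ q → (v ~? q) ×-dec (q ~? x))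
      ... | yes vx | _      | _                  = _ , near vx
      ... | no ¬vx | yes px | _                  = _ , atP (¬~⇒≁ ¬vx) px
      ... | no ¬vx | no ¬px | yes (q , vq , qx)  = _ , mid (¬~⇒≁ ¬vx) (¬~⇒≁ ¬px) vq qx
      ... | no ¬vx | no ¬px | no ¬q              = _ , far (¬~⇒≁ ¬vx) (¬~⇒≁ ¬px) ¬q

      -- An edge inside `atP` or `near` closes a triangle with p or v, and an edge from `near` to
      -- `far` would put its far end at distance 2. An edge xy inside `mid` gives the induced path
      -- p, v, q, x, y; inside `far` it gives v, s, q, x, y along a shortest path to x.
      conflict : ∀ {c} → v ↝ x → x ~ y → Layer x c → Layer y c → ⊥
      conflict r xy (atP _ px)  (atP _ py)   = ¬triangle r xy (~-sym py) (~-sym px)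
      conflict r xy (near vx)   (near vy)    = ¬triangle ε vx xy vy
      conflict r xy (near vx)   (far _ _ ¬q) = ¬q (_ , vx , xy)
      conflict r xy (far _ _ ¬q) (near vy)   = ¬q (_ , vy , ~-sym xy)
      conflict {x} {y} r xy (mid {q} vx px vq qx) (mid vy py _ _) = ¬inducedP5
        ( p , v , ~-sym vp
        , q , (vq , ¬~⇒≁ λ pq → ¬triangle ε vp pq vq)
        , x , (qx , vx , px)
        , y , xy , (¬~⇒≁ λ qy → ¬triangle r xy (~-sym qy) (~-sym qx)) , vy , py )
      conflict {x} {y} r xy (far vx px ¬qx) (far vy py ¬qy) with ↝⇒within₃ r
      ... | inj₁ refl = true≢false (~-sym vp) px
      ... | inj₂ (inj₁ vx′) = true≢false vx′ vx
      ... | inj₂ (inj₂ (inj₁ q)) = ¬qx q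
      ... | inj₂ (inj₂ (inj₂ (s , vs , q , sq , qx))) = ¬inducedP5
        ( v , s , vs
        , q , (sq , ¬~⇒≁ λ vq → ¬qx (q , vq , qx))
        , x , (qx , (¬~⇒≁ λ sx → ¬qx (s , vs , sx)) , vx)
        , y , xy , (¬~⇒≁ λ qy → ¬triangle r xy (~-sym qy) (~-sym qx)) ,
              (¬~⇒≁ λ sy → ¬qy (s , vs , sy)) , vy )

      colours : ∀ {k} → 3 ≤ k → ColoursComponent k v
      colours 3≤k = (λ x → inject≤ (proj₁ (layer x)) 3≤k) , λ {x} {y} r xy eq →
        conflict r xy (proj₂ (layer x))
          (subst (Layer y) (≡.sym (Fin.inject≤-injective _ _ _ _ eq)) (proj₂ (layer y)))

    -- Components with a triangle.

    module _ (w : ℕ) (¬clique : ¬ HasClique G (suc w)) where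

      clique≤w : {S : Fin k → V} → Pairwise~ S → k ≤ w
      clique≤w {k} {S} S~ = ℕ.≮⇒≥ λ w<k → ¬clique
        ( (λ i → S (inject≤ i w<k))
        , (λ eq → Fin.inject≤-injective _ _ _ _ (pairwise~⇒injective S~ eq))
        , λ i j i≢j → S~ _ _ (i≢j ∘ Fin.inject≤-injective _ _ _ _) )

      -- Greedy extension with fuel `d`: when it runs out, w ≤ k, so a clique on 3 + k vertices is
      -- already too large. The walk from `S (# 0)` records that the component stays the same.
      maximalClique : ∀ d {k} → w ≤ d + k → (S : Fin (3 + k) → V) → Pairwise~ S → ∃ λ k′ →
        Σ (Fin (3 + k′) → V) λ S′ → Pairwise~ S′ × (∀ x → ∃ λ i → S′ i ≁ x) × ∃ λ i → S (# 0) ↝ S′ i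
      maximalClique d {k} w≤ S S~ with Fin.any? (λ x → Fin.all? λ i → S i ~? x)
      ... | no ¬ext = k , S , S~ ,
              (λ x → decidable-stable (Fin.any? λ i → adj G (S i) x Bool.≟ false)
                       λ h → ¬ext (x , λ i → Bool.¬-not λ ix → h (i , ix))) , # 0 , ε
      maximalClique zero w≤ S S~ | yes _ =
        ⊥-elim (ℕ.<-irrefl refl (ℕ.≤-trans (s≤s w≤) (ℕ.≤-trans (ℕ.m≤n+m _ 2) (clique≤w S~))))
      maximalClique (suc d) {k} w≤ S S~ | yes (x , h)
        with k′ , S′ , S′~ , max , i , r ← maximalClique d (subst (w ≤_) (≡.sym (ℕ.+-suc d k)) w≤)
                                             (x VF.∷ S) (pairwise~-∷ S~ h) =
        k′ , S′ , S′~ , max , i , (h zero ◅ r)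

      module _ {a b c x y} (3≤w : 3 ≤ w)
        (ab : a ~ b) (ac : a ~ c) (bc : b ~ c) (xa : x ~ a) (xb : x ≁ b) (xy : x ~ y)
        (b≢x : b ≢ x) (c≢x : c ≢ x) (a≢y : a ≢ y) (b≢y : b ≢ y) (c≢y : c ≢ y)
        (¬yabc : y ≁ a ⊎ y ≁ b ⊎ y ≁ c) where

        private
          S : Fin 5 → V
          S = y VF.∷ x VF.∷ c VF.∷ b VF.∷ a VF.∷ VF.[]

          bits : Vec Bool 4
          bits = adj G y c ∷ adj G y b ∷ adj G y a ∷ adj G x c ∷ []

          add : ∀ {m e M} → Copy (adj G) e (entry M) → ∀ {z r} →
                (∀ i → e i ≢ z) → (∀ i → adj G z (e i) ≡ lookup r i) →
                Copy (adj G) (z VF.∷ e) (entry {suc m} (r , M))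
          add = copy-∷ (sym G) (irrefl G)

          copy₁ = add copy-[] {a} {[]} (λ ()) (λ ())
          copy₂ = add copy₁ {b} {true ∷ []} (λ { zero → ~⇒≢ ab }) (λ { zero → ~-sym ab })
          copy₃ = add copy₂ {c} {true ∷ true ∷ []}
            (λ { zero → ~⇒≢ bc ; (suc zero) → ~⇒≢ ac })
            (λ { zero → ~-sym bc ; (suc zero) → ~-sym ac })
          copy₄ = add copy₃ {x} {adj G x c ∷ false ∷ true ∷ []}
            (λ { zero → c≢x ; (suc zero) → b≢x ; (suc (suc zero)) → ~⇒≢ (~-sym xa) })
            (λ { zero → refl ; (suc zero) → xb ; (suc (suc zero)) → xa })

          copy₅ : Copy (adj G) S (entry (triangleWithEdge bits))
          copy₅ = add copy₄
            (λ { zero → ~⇒≢ xy ; (suc zero) → c≢y ; (suc (suc zero)) → b≢y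
               ; (suc (suc (suc zero))) → a≢y })
            (λ { zero → ~-sym xy ; (suc zero) → refl ; (suc (suc zero)) → refl
               ; (suc (suc (suc zero))) → refl })

          zeroBit : ∃ λ (i : Fin 3) → lookup bits (Fin.inject₁ i) ≡ false
          -- The first three bits are the adjacencies of y to c, b, a, hence the reversed indices.
          zeroBit = [ (# 2 ,_) , [ (# 1 ,_) , (# 0 ,_) ]′ ]′ ¬yabc

          row : V → Vec Bool 5
          row z = tabulate λ i → adj G z (S i)

          adj≡row : ∀ z i → adj G z (S i) ≡ lookup (row z) i
          adj≡row z i = ≡.sym (lookup∘tabulate (λ i → adj G z (S i)) i)

        -- As 3 ≤ w, the three colours from the finite check fit into w, and one more colours the
        -- rest. An attached edge zz' is refuted by the six- or seven-vertex alternative of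
        -- `Special`.
        triangleWithEdge⇒colours : ColoursComponent (suc w) a
        triangleWithEdge⇒colours with triangleWithEdge-special bits zeroBit
        ... | inj₁ h = ⊥-elim (¬p5Among copy₅ _ h)
        ... | inj₂ ((c , proper) , ext)
          with colour-or-attachedEdge S (λ i → inject≤ (lookup c i) 3≤w)
                 (λ i j ij → proper i j (trans (≡.sym (Copy.agrees copy₅ i j)) ij)
                             ∘ Fin.inject≤-injective _ _ _ _)
                 (# 4)
        ...   | inj₁ colours = colours
        ...   | inj₂ (i , z , z′ , iz , zz′ , ¬z , ¬z′) =
          ⊥-elim ([ ¬p5Among copy₆ _ , (λ h → ¬p5Among copy₇ _ (h (row z′))) ]′
                    (ext (row z) (i , trans (≡.sym (adj≡row z i)) (~-sym iz))))
          where
          copy₆ : Copy (adj G) (z VF.∷ S) (entry {6} (row z , triangleWithEdge bits))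
          copy₆ = add copy₅ (λ i p → ¬z (i , p)) (adj≡row z)
          copy₇ : Copy (adj G) (z′ VF.∷ z VF.∷ S)
                    (entry {7} (true ∷ row z′ , row z , triangleWithEdge bits))
          copy₇ = add copy₆ (λ { zero → ~⇒≢ zz′ ; (suc i) p → ¬z′ (i , p) })
                    (λ { zero → ~-sym zz′ ; (suc i) → adj≡row z′ i })

      -- In the triangle, a is the clique vertex to which x is attached and b one that x misses. For
      -- c take the vertex `l` missed by y if it differs from both; otherwise y already misses a or
      -- b, and any third vertex does.
      cliqueWithEdge⇒colours : (S : Fin (3 + k) → V) → Pairwise~ S → (∀ x → ∃ λ i → S i ≁ x) →
                               AttachedEdge S → ∃ λ i → ColoursComponent (suc w) (S i)
      cliqueWithEdge⇒colours S S~ max (i , x , y , ix , xy , ¬x , ¬y)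
        with j , jx ← max x | l , ly ← max y = i , colours
        where
        i≢j : i ≢ j
        i≢j refl = true≢false ix jx
        via : ∀ c → c ≢ i → c ≢ j → y ≁ S i ⊎ y ≁ S j ⊎ y ≁ S c → ColoursComponent (suc w) (S i)
        via c c≢i c≢j = triangleWithEdge⇒colours
          (ℕ.≤-trans (ℕ.m≤m+n 3 _) (clique≤w S~))
          (S~ i j i≢j) (S~ i c (c≢i ∘ ≡.sym)) (S~ j c (c≢j ∘ ≡.sym))
          (~-sym ix) (≁-sym jx) xy
          (λ p → ¬x (j , p)) (λ p → ¬x (c , p))
          (λ p → ¬y (i , p)) (λ p → ¬y (j , p)) (λ p → ¬y (c , p))
        colours : ColoursComponent (suc w) (S i)
        colours with third i j | l ≟ i | l ≟ j
        ... | c , c≢i , c≢j | yes refl | _ = via c c≢i c≢j (inj₁ (≁-sym ly))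
        ... | c , c≢i , c≢j | no _ | yes refl = via c c≢i c≢j (inj₂ (inj₁ (≁-sym ly)))
        ... | _ | no l≢i | no l≢j = via l l≢i l≢j (inj₂ (inj₂ (≁-sym ly)))

      triangle⇒colours : ∀ {a b c} → a ~ b → b ~ c → a ~ c → ColoursComponent (suc w) a
      triangle⇒colours {a} {b} {c} ab bc ac
        with k , S , S~ , max , i , ai ← maximalClique w (ℕ.m≤m+n w 0) (a VF.∷ b VF.∷ c VF.∷ VF.[])
               (pairwise~-∷ (pairwise~-∷ (pairwise~-∷ pairwise~-[] λ ())
                 λ { zero → ~-sym bc }) λ { zero → ~-sym ab ; (suc zero) → ~-sym ac })
        -- The clique is coloured by its own indices, of which there are at most w.
        with colour-or-attachedEdge S (λ j → inject≤ j (clique≤w S~))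
               (λ j l jl eq → ~⇒≢ jl (cong S (Fin.inject≤-injective _ _ _ _ eq))) i
      ... | inj₁ colours = coloursComponent-↝ ai colours
      ... | inj₂ edge with j , colours ← cliqueWithEdge⇒colours S S~ max edge =
        coloursComponent-↝ (ai ◅◅ pairwise~⇒↝ S~ i j) colours

      coloursComponent : ∀ v → ColoursComponent (suc w) v
      coloursComponent v with Fin.any? (v ~?_)
      -- An isolated vertex: its component has no edge.
      ... | no ¬p = (λ _ → zero) , λ { ε vy _ → ¬p (_ , vy) ; (vx ◅ _) _ _ → ¬p (_ , vx) }
      ... | yes (p , vp) with Fin.any? (λ a → Fin.any? λ b → Fin.any? λ c →
                                (v ↝? a) ×-dec (a ~? b) ×-dec (b ~? c) ×-dec (a ~? c))
      ...   | yes (a , b , c , va , ab , bc , ac) = coloursComponent-↝ va (triangle⇒colours ab bc ac)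
      ...   | no ¬t = TriangleFree.colours vp
                        (λ va ab bc ac → ¬t (_ , _ , _ , va , ab , bc , ac))
                        -- The edge vp is a clique on two vertices, so w + 1 is at least 3.
                        (s≤s (clique≤w (pairwise~-∷ (pairwise~-∷ pairwise~-[] λ ())
                                          λ { zero → vp })))

theorem5p3 : (G : Graph) → ¬ HasP5VertexMinor G →
    (w : ℕ) → IsCliqueNumber G w → Colorable G (suc w)
theorem5p3 G noP5 w (_ , ¬clique) =
  coloursComponents⇒colourable G (_↝?_ G noP5) (coloursComponent G noP5 w ¬clique)
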